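{- Let $p,q$ be integers with $\min\{p,q\}\ge 2$. If $p\ne q$, then the automorphism group $\operatorname{Aut}(\Pi_{p,q})$ is isomorphic to $\mathbb{Z}_2$; and if $p=q$, then $\operatorname{Aut}(\Pi_{p,q})$ is isomorphic to $\mathbb{Z}_2\times\mathbb{Z}_2$.
   Context: For nonnegative integers $p,q$, the graph $\Pi_{p,q}$ is the simple graph whose vertices are all integer sequences $(\lambda_1,\dots,\lambda_q)$ with $p\ge\lambda_1\ge\cdots\ge\lambda_q\ge 0$ (weak partitions into $q$ parts, parts $0$ allowed, with largest part at most $p$); two vertices are adjacent if one can be obtained from the other by adding $1$ to one of the parts. -}

module Defs where

open import Algebra.Bundles using (Group)
import Algebra.Construct.DirectProduct as DirectProduct
open import Algebra.Morphism.Structures using (IsGroupIsomorphism)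
import Data.Parity.Properties as Parity
open import Data.Nat.Base using (ℕ; suc; _≥_)
open import Data.Nat.Properties using (≤-irrelevant; 1+n≢n)
open import Data.Product.Base using (∃; ∃-syntax; _,_)
open import Data.Sum.Base using (_⊎_; inj₁; inj₂; swap)
open import Data.Vec.Base using (Vec; _∷_; lookup; _[_]%=_)
open import Data.Vec.Properties using (lookup∘updateAt)
open import Data.Vec.Relation.Unary.Linked using (Linked; irrelevant)
open import Function.Bundles using (_↔_; _⇔_; mk⇔; Inverse; Equivalence)
open import Function.Construct.Composition using (_↔-∘_; _⇔-∘_)
open import Function.Construct.Identity using (↔-id; ⇔-id)
open import Function.Construct.Symmetry using (↔-sym)
open import Level using (Level; 0ℓ; _⊔_)
open import Relation.Binary.Core using (Rel)
open import Relation.Binary.Definitions using (Symmetric)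
open import Relation.Binary.PropositionalEquality
  using (_≡_; refl; sym; trans; cong; subst₂)
open import Relation.Nullary.Negation using (¬_)

record SimpleGraph : Set₁ where
  infix 4 _~_
  field
    Vertex   : Set
    _~_      : Rel Vertex 0ℓ
    ~-sym    : Symmetric _~_
    ~-irrefl : ∀ {x} → ¬ (x ~ x)

module _ (Γ : SimpleGraph) where
  open SimpleGraph Γ
  open Inverse using (to; from; strictlyInverseˡ; strictlyInverseʳ)

  record Automorphism : Set where
    field
      bijection : Vertex ↔ Vertex
      adjacency : ∀ x y → (x ~ y) ⇔ (to bijection x ~ to bijection y)

    apply : Vertex → Vertex
    apply = to bijection

  open Automorphism

  private
    inverse : Automorphism → Automorphism
    inverse f = record
      { bijection = ↔-sym b
      ; adjacency = λ x y → mk⇔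
          (λ x~y → Equivalence.from (adjacency f (from b x) (from b y))
                     (subst₂ _~_ (sym (strictlyInverseˡ b x)) (sym (strictlyInverseˡ b y)) x~y))
          (λ x~y → subst₂ _~_ (strictlyInverseˡ b x) (strictlyInverseˡ b y)
                     (Equivalence.to (adjacency f (from b x) (from b y)) x~y))
      }
      where b = bijection f

  -- Automorphisms are identified when they agree at every vertex, and the
  -- product f ∙ g is "g, then f".
  Aut : Group 0ℓ 0ℓ
  Aut = record
    { Carrier = Automorphism
    ; _≈_     = λ f g → ∀ x → apply f x ≡ apply g x
    ; _∙_     = λ f g → record
        { bijection = bijection f ↔-∘ bijection g
        ; adjacency = λ x y → adjacency f (apply g x) (apply g y) ⇔-∘ adjacency g x y
        }
    ; ε       = record { bijection = ↔-id _ ; adjacency = λ _ _ → ⇔-id _ }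
    ; _⁻¹     = inverse
    ; isGroup = record
        { isMonoid = record
            { isSemigroup = record
                { isMagma = record
                    { isEquivalence = record
                        { refl  = λ _ → refl
                        ; sym   = λ f≈g x → sym (f≈g x)
                        ; trans = λ f≈g g≈h x → trans (f≈g x) (g≈h x)
                        }
                    ; ∙-cong = λ {f} {f′} {g} {g′} f≈f′ g≈g′ x →
                        trans (cong (apply f) (g≈g′ x)) (f≈f′ (apply g′ x))
                    }
                ; assoc = λ _ _ _ _ → refl
                }
            ; identity = (λ _ _ → refl) , (λ _ _ → refl)
            }
        ; inverse = (λ f → strictlyInverseʳ (bijection f))
                  , (λ f → strictlyInverseˡ (bijection f))
        ; ⁻¹-cong = λ {f} {g} f≈g x →
            trans (cong (from (bijection f))
                    (sym (trans (f≈g (from (bijection g) x))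
                                (strictlyInverseˡ (bijection g) x))))
                  (strictlyInverseʳ (bijection f) (from (bijection g) x))
        }
    }

record BoxPartition (p q : ℕ) : Set where
  constructor mkBoxPartition
  field
    parts : Vec ℕ q
    -- p ≥ λ₁ ≥ ⋯ ≥ λ_q
    chain : Linked _≥_ (p ∷ parts)

open BoxPartition public

-- Equality of vertices is equality of the underlying sequences.
parts-injective : ∀ {p q} {x y : BoxPartition p q} → parts x ≡ parts y → x ≡ y
parts-injective {x = mkBoxPartition v c} {mkBoxPartition .v d} refl =
  cong (mkBoxPartition v) (irrelevant ≤-irrelevant c d)

AddsOne : ∀ {p q} → Rel (BoxPartition p q) 0ℓ
AddsOne x y = ∃[ i ] parts y ≡ parts x [ i ]%= suc

Π : ℕ → ℕ → SimpleGraph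
Π p q = record
  { Vertex   = BoxPartition p q
  ; _~_      = λ x y → AddsOne x y ⊎ AddsOne y x
  ; ~-sym    = swap
  ; ~-irrefl = λ { {x} (inj₁ e) → notSelf x e ; {x} (inj₂ e) → notSelf x e }
  }
  where
  notSelf : ∀ x → ¬ AddsOne x x
  notSelf x (i , eq) =
    1+n≢n (sym (trans (cong (λ v → lookup v i) eq) (lookup∘updateAt i (parts x))))

infix 4 _≅_

_≅_ : ∀ {a b ℓ₁ ℓ₂ : Level} → Group a ℓ₁ → Group b ℓ₂ → Set (a ⊔ b ⊔ ℓ₁ ⊔ ℓ₂)
G ≅ H = ∃ λ f → IsGroupIsomorphism (Group.rawGroup G) (Group.rawGroup H) f

-- Addition modulo 2 on {0ℙ , 1ℙ}.
ℤ₂ : Group 0ℓ 0ℓ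
ℤ₂ = Parity.+-0-group

infixr 7 _×ᴳ_

_×ᴳ_ : ∀ {a b ℓ₁ ℓ₂ : Level} → Group a ℓ₁ → Group b ℓ₂ → Group (a ⊔ b) (ℓ₁ ⊔ ℓ₂)
_×ᴳ_ = DirectProduct.group

{-# OPTIONS --safe #-}
module Submission where

-- Vertices are viewed as down-closed sets of cells of the q × p grid, with a
-- cover relation adding one cell.  Every vertex but the empty and the full one
-- has both a lower and an upper cover, so these two are the only ones with a
-- unique neighbour; after composing with the complement an automorphism fixes
-- the empty one, hence preserves ranks and covers.  Such a map is determined by
-- its values on the two rectangles of size 2: a vertex with two lower covers is
-- their union, any other is a rectangle, and two rectangles with a common lower
-- cover coincide unless they are those two.  If those two are exchanged, the map
-- is the transposition on cells, which forces the box to be square.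

open import Defs
open import Algebra.Bundles using (Group)
open import Data.Nat.Base using (ℕ; zero; suc; _+_; _∸_; _⊓_; _≤_; _<_; _≥_; z≤n; s≤s; z<s; s<s; s≤s⁻¹)
open import Data.Nat.Properties
  using (_≟_; _≤?_; _<?_; ≤-refl; ≤-reflexive; ≤-trans; ≤-antisym; <-irrefl; <⇒≤; <⇒≢; <⇒≱; ≮⇒≥;
         ≤-<-trans; <-≤-trans; ≤-<-connex; ≤∧≢⇒<; n<1+n; m<n⇒m<1+n; m≤n⇒m<n∨m≡n; n≤0⇒n≡0; +-suc; m⊓n≤m;
         m⊓n≤n; n≤1+n; ∸-monoʳ-≤; m∸[m∸n]≡n; ∸-monoʳ-<; suc-injective)
open import Data.Empty using (⊥; ⊥-elim)
open import Data.Fin.Base using (Fin; zero; suc; toℕ; fromℕ<)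
open import Data.Fin.Properties using (toℕ-fromℕ<)
open import Data.Parity.Base using (Parity; 0ℙ; 1ℙ) renaming (_+_ to _+ᵖ_)
open import Data.Product.Base using (Σ; ∃-syntax; _×_; _,_; proj₁; proj₂; swap)
open import Data.Product.Properties using (≡-dec)
open import Data.Sum.Base using (_⊎_; inj₁; inj₂; [_,_]′) renaming (swap to swap⊎)
open import Data.Vec.Base using (Vec; []; _∷_; sum; _[_]%=_)
open import Data.Vec.Relation.Unary.Linked using (Linked; [-]; _∷_)
open import Function.Base using (_∘_; id)
open import Function.Bundles using (Inverse; Equivalence; mk⇔; mk↔ₛ′)
open import Level using (0ℓ)
open import Relation.Binary.Definitions using (DecidableEquality)
open import Relation.Binary.PropositionalEquality
  using (_≡_; _≢_; refl; sym; trans; cong; cong₂; subst; subst₂)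
open import Relation.Nullary.Decidable using (yes; no; ¬?; _×-dec_)
open import Relation.Nullary.Negation using (¬_; contradiction)
open import Relation.Unary using (Pred; Decidable; _∈_; _∉_; _⊆_; _≐_; _∪_; ｛_｝)
open import Relation.Unary.Properties using (≐-refl; ≐-sym; ≐-trans)

-- Cell sets and the cover relation.

Cell : Set
Cell = ℕ × ℕ

CellSet : Set₁
CellSet = Pred Cell 0ℓ

infix 4 _≤ᶜ_ _≟ᶜ_ _⋖_

_≤ᶜ_ : Cell → Cell → Set
(i , j) ≤ᶜ (k , l) = i ≤ k × j ≤ l

_≟ᶜ_ : DecidableEquality Cell
_≟ᶜ_ = ≡-dec _≟_ _≟_

≤ᶜ-refl : ∀ {a} → a ≤ᶜ a
≤ᶜ-refl = ≤-refl , ≤-refl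

≤ᶜ-antisym : ∀ {a b} → a ≤ᶜ b → b ≤ᶜ a → a ≡ b
≤ᶜ-antisym (i≤k , j≤l) (k≤i , l≤j) with refl ← ≤-antisym i≤k k≤i | refl ← ≤-antisym j≤l l≤j = refl

DownClosed : CellSet → Set
DownClosed X = ∀ {c d} → c ≤ᶜ d → d ∈ X → c ∈ X

↓_ : Cell → CellSet
(↓ a) d = d ≤ᶜ a

infixl 6 _∖_

_∖_ : CellSet → Cell → CellSet
(X ∖ c) d = d ∈ X × d ≢ c

-- Sets of cells are predicates, so the larger set is pinned down only up to `≐`. Neither set is
-- required to be down-closed, hence that assumption appears separately where it is used.
_⋖_ : CellSet → CellSet → Set
X ⋖ Y = ∃[ c ] c ∉ X × Y ≐ X ∪ ｛ c ｝

⋖-resp-≐ : ∀ {X X′ Y Y′} → X ≐ X′ → Y ≐ Y′ → X ⋖ Y → X′ ⋖ Y′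
⋖-resp-≐ (X⊆X′ , X′⊆X) (Y⊆Y′ , Y′⊆Y) (c , c∉X , Y⊆ , ⊆Y) =
  c , (λ c∈X′ → c∉X (X′⊆X c∈X′))
    , (λ d∈Y′ → [ inj₁ ∘ X⊆X′ , inj₂ ]′ (Y⊆ (Y′⊆Y d∈Y′)))
    , (λ d∈ → Y⊆Y′ (⊆Y ([ inj₁ ∘ X′⊆X , inj₂ ]′ d∈)))

⋖⇒⊆ : ∀ {X Y} → X ⋖ Y → X ⊆ Y
⋖⇒⊆ (_ , _ , _ , ⊆Y) d∈X = ⊆Y (inj₁ d∈X)

∖-⋖ : ∀ {X c} → c ∈ X → (X ∖ c) ⋖ X
∖-⋖ {X} {c} c∈X = c , (λ c∈ → proj₂ c∈ refl) , split , [ proj₁ , (λ { refl → c∈X }) ]′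
  where
  split : X ⊆ (X ∖ c) ∪ ｛ c ｝
  split {d} d∈X with d ≟ᶜ c
  ... | yes refl = inj₂ refl
  ... | no d≢c = inj₁ (d∈X , d≢c)

-- A set with two distinct lower covers is their union.
⊆-of-two-lower-covers : ∀ {U V U′ V′ X Y : CellSet} → U ⋖ X → V ⋖ X → ¬ (U ≐ V) →
  U ≐ U′ → V ≐ V′ → U′ ⊆ Y → V′ ⊆ Y → X ⊆ Y
⊆-of-two-lower-covers {U} {V} {X = X} (c , c∉U , X⊆Uc , Uc⊆X) (c′ , c′∉V , X⊆Vc′ , Vc′⊆X) U≢V
    (U⊆U′ , _) (V⊆V′ , _) U′⊆Y V′⊆Y d∈X with X⊆Uc d∈X
... | inj₁ d∈U = U′⊆Y (U⊆U′ d∈U)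
... | inj₂ refl with X⊆Vc′ d∈X
...   | inj₁ c∈V = V′⊆Y (V⊆V′ c∈V)
...   | inj₂ refl = ⊥-elim (U≢V ((λ {_} → U⊆V) , V⊆U))
  where
  U⊆V : U ⊆ V
  U⊆V d∈U with X⊆Vc′ (Uc⊆X (inj₁ d∈U))
  ... | inj₁ d∈V = d∈V
  ... | inj₂ refl = contradiction d∈U c∉U
  V⊆U : V ⊆ U
  V⊆U d∈V with X⊆Uc (Vc′⊆X (inj₁ d∈V))
  ... | inj₁ d∈U = d∈U
  ... | inj₂ refl = contradiction d∈V c′∉V

-- Each of `X` and `Y` is the union of its two given lower covers, and these agree in pairs, so each
-- union lies in the other.
two-lower-covers-unique : ∀ {U V U′ V′ X Y : CellSet} → U ⋖ X → V ⋖ X → U′ ⋖ Y → V′ ⋖ Y →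
  U ≐ U′ → V ≐ V′ → ¬ (U ≐ V) → X ≐ Y
two-lower-covers-unique U⋖X V⋖X U′⋖Y V′⋖Y U≐U′ V≐V′ U≢V =
  ⊆-of-two-lower-covers U⋖X V⋖X U≢V U≐U′ V≐V′ (⋖⇒⊆ U′⋖Y) (⋖⇒⊆ V′⋖Y) ,
  ⊆-of-two-lower-covers U′⋖Y V′⋖Y
    (λ U′≐V′ → U≢V (≐-trans U≐U′ (≐-trans U′≐V′ (≐-sym V≐V′))))
    (≐-sym U≐U′) (≐-sym V≐V′) (⋖⇒⊆ U⋖X) (⋖⇒⊆ V⋖X)

-- Rectangles and their common lower covers.

lower-cover-of-rectangle : ∀ {M X a} → DownClosed M → M ⋖ X → X ≐ ↓ a → M ≐ ↓ a ∖ a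
lower-cover-of-rectangle {M} {X} {a} down (c , c∉M , X⊆ , ⊆X) (X⊆↓a , ↓a⊆X) =
  (λ { d∈M → X⊆↓a (⊆X (inj₁ d∈M)) , (λ { refl → a∉M d∈M }) }) , back
  where
  -- The added cell `c` lies below `a`; if `a` were in `M`, down-closure would put `c` there too.
  a∉M : a ∉ M
  a∉M a∈M = c∉M (down (X⊆↓a (⊆X (inj₂ refl))) a∈M)
  c≡a : c ≡ a
  c≡a with X⊆ (↓a⊆X ≤ᶜ-refl)
  ... | inj₁ a∈M = contradiction a∈M a∉M
  ... | inj₂ c≡a = c≡a
  back : ↓ a ∖ a ⊆ M
  back (d≤a , d≢a) with X⊆ (↓a⊆X d≤a)
  ... | inj₁ d∈M = d∈M
  ... | inj₂ refl = contradiction c≡a d≢a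

-- If a = (a₁ , a₂) and b = (b₁ , b₂) are incomparable, moving a up or b left
-- stays in M, which pins both corners down.
incomparable-corners : ∀ {M : CellSet} {a b} → M ≐ ↓ a ∖ a → M ≐ ↓ b ∖ b →
  proj₁ a < proj₁ b → proj₂ b < proj₂ a → a ≡ (0 , 1) × b ≡ (1 , 0)
incomparable-corners {a = suc a₁ , a₂} (_ , ⊆M) (M⊆ , _) a₁<b₁ b₂<a₂
  with (_ , a₂≤b₂) , _ ← M⊆ (⊆M {a₁ , a₂} ((n≤1+n _ , ≤-refl) , λ ()))
  = contradiction a₂≤b₂ (<⇒≱ b₂<a₂)
incomparable-corners {b = b₁ , suc b₂} (M⊆ , _) (_ , ⊆M) a₁<b₁ b₂<a₂
  with (b₁≤a₁ , _) , _ ← M⊆ (⊆M {b₁ , b₂} ((≤-refl , n≤1+n _) , λ ()))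
  = contradiction b₁≤a₁ (<⇒≱ a₁<b₁)
incomparable-corners {a = 0 , suc 0} {suc 0 , 0} _ _ _ _ = refl , refl
incomparable-corners {a = 0 , suc (suc k)} {b₁ , 0} (_ , ⊆M) (M⊆ , _) _ _
  with (_ , ()) , _ ← M⊆ (⊆M {0 , suc k} ((z≤n , n≤1+n _) , λ ()))
incomparable-corners {a = 0 , suc 0} {suc (suc k) , 0} (M⊆ , _) (_ , ⊆M) _ _
  with (() , _) , _ ← M⊆ (⊆M {suc k , 0} ((n≤1+n _ , z≤n) , λ ()))

-- If `a` lies strictly below `b`, then `a` belongs to `↓ b` without `b`, which is `M`, although `M`
-- is also `↓ a` without `a`.
comparable-corners : ∀ {M : CellSet} {a b} → M ≐ ↓ a ∖ a → M ≐ ↓ b ∖ b → a ≤ᶜ b → a ≡ b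
comparable-corners {a = a} {b} (M⊆ , _) (_ , ⊆M) a≤b with a ≟ᶜ b
... | yes a≡b = a≡b
... | no a≢b = contradiction refl (proj₂ (M⊆ (⊆M (a≤b , a≢b))))

rectangles-over-common-lower-cover : ∀ {M : CellSet} {a b} → M ≐ ↓ a ∖ a → M ≐ ↓ b ∖ b →
  a ≡ b ⊎ (a ≡ (0 , 1) × b ≡ (1 , 0)) ⊎ (b ≡ (0 , 1) × a ≡ (1 , 0))
rectangles-over-common-lower-cover {a = a₁ , a₂} {b₁ , b₂} p q with ≤-<-connex a₁ b₁ | ≤-<-connex a₂ b₂
... | inj₁ a₁≤b₁ | inj₁ a₂≤b₂ = inj₁ (comparable-corners p q (a₁≤b₁ , a₂≤b₂))
... | inj₂ b₁<a₁ | inj₂ b₂<a₂ = inj₁ (sym (comparable-corners q p (<⇒≤ b₁<a₁ , <⇒≤ b₂<a₂)))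
... | inj₁ a₁≤b₁ | inj₂ b₂<a₂ with ≤-<-connex b₁ a₁
...   | inj₁ b₁≤a₁ = inj₁ (sym (comparable-corners q p (b₁≤a₁ , <⇒≤ b₂<a₂)))
...   | inj₂ a₁<b₁ = inj₂ (inj₁ (incomparable-corners p q a₁<b₁ b₂<a₂))
rectangles-over-common-lower-cover {a = a₁ , a₂} {b₁ , b₂} p q | inj₂ b₁<a₁ | inj₁ a₂≤b₂ with ≤-<-connex b₂ a₂
...   | inj₁ b₂≤a₂ = inj₁ (sym (comparable-corners q p (<⇒≤ b₁<a₁ , b₂≤a₂)))
...   | inj₂ a₂<b₂ = inj₂ (inj₂ (incomparable-corners q p b₁<a₁ a₂<b₂))

-- Rows of a vector of parts.

-- Rows are indexed from 0, and rows beyond the last part have length 0.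
row : ∀ {n} → Vec ℕ n → ℕ → ℕ
row [] _ = 0
row (m ∷ v) zero = m
row (m ∷ v) (suc i) = row v i

row-≤-bound : ∀ {n b} {v : Vec ℕ n} → Linked _≥_ (b ∷ v) → ∀ i → row v i ≤ b
row-≤-bound [-] _ = z≤n
row-≤-bound {v = _ ∷ _} (b≥m ∷ _) zero = b≥m
row-≤-bound {v = _ ∷ _} (b≥m ∷ ch) (suc i) = ≤-trans (row-≤-bound ch i) b≥m

row-antitone : ∀ {n b} {v : Vec ℕ n} → Linked _≥_ (b ∷ v) → ∀ {i k} → i ≤ k → row v k ≤ row v i
row-antitone [-] _ = z≤n
row-antitone {v = _ ∷ _} (_ ∷ ch) {k = zero} z≤n = ≤-refl
row-antitone {v = _ ∷ _} (_ ∷ ch) {k = suc k} z≤n = row-≤-bound ch k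
row-antitone {v = _ ∷ _} (_ ∷ ch) (s≤s i≤k) = row-antitone ch i≤k

row-nonzero⇒< : ∀ {n j} (v : Vec ℕ n) i → j < row v i → i < n
row-nonzero⇒< (_ ∷ _) zero _ = z<s
row-nonzero⇒< (_ ∷ v) (suc i) j<r = s<s (row-nonzero⇒< v i j<r)

row-injective : ∀ {n} {v w : Vec ℕ n} → (∀ i → row v i ≡ row w i) → v ≡ w
row-injective {v = []} {[]} _ = refl
row-injective {v = m ∷ v} {k ∷ w} eq with refl ← eq 0 | refl ← row-injective {v = v} {w} (eq ∘ suc) = refl

row-updateAt : ∀ {n} (v : Vec ℕ n) i f → row (v [ i ]%= f) (toℕ i) ≡ f (row v (toℕ i))
row-updateAt (_ ∷ _) zero f = refl
row-updateAt (_ ∷ v) (suc i) f = row-updateAt v i f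

row-updateAt-≢ : ∀ {n} (v : Vec ℕ n) i f {k} → k ≢ toℕ i → row (v [ i ]%= f) k ≡ row v k
row-updateAt-≢ (_ ∷ _) zero f {zero} k≢i = contradiction refl k≢i
row-updateAt-≢ (_ ∷ _) zero f {suc k} _ = refl
row-updateAt-≢ (_ ∷ _) (suc i) f {zero} _ = refl
row-updateAt-≢ (_ ∷ v) (suc i) f {suc k} k≢i = row-updateAt-≢ v i f (k≢i ∘ cong suc)

tabulateRows : ∀ n → (ℕ → ℕ) → Vec ℕ n
tabulateRows zero _ = []
tabulateRows (suc n) r = r 0 ∷ tabulateRows n (r ∘ suc)

row-tabulateRows : ∀ {n} r {i} → i < n → row (tabulateRows n r) i ≡ r i
row-tabulateRows r {zero} z<s = refl
row-tabulateRows r {suc i} (s≤s i<n) = row-tabulateRows (r ∘ suc) i<n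

tabulateRows-chain : ∀ n {b r} → r 0 ≤ b → (∀ i → r (suc i) ≤ r i) → Linked _≥_ (b ∷ tabulateRows n r)
tabulateRows-chain zero _ _ = [-]
tabulateRows-chain (suc n) r0≤b anti = r0≤b ∷ tabulateRows-chain n (anti 0) (anti ∘ suc)

-- Initial segments of the natural numbers and bounded search.

⊆⇒≤ : ∀ {m n} → (∀ {j} → j < m → j < n) → m ≤ n
⊆⇒≤ {zero} _ = z≤n
⊆⇒≤ {suc m} sub = sub (n<1+n m)

-- The length of the initial run of elements of `P`, cut off at the bound. For a down-closed `P`
-- this run contains every element below the bound.
height : ∀ {P : Pred ℕ 0ℓ} → Decidable P → ℕ → ℕ
height P? zero = zero
height P? (suc n) with P? 0
... | yes _ = suc (height (P? ∘ suc) n)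
... | no _ = zero

height-≤ : ∀ {P : Pred ℕ 0ℓ} (P? : Decidable P) n → height P? n ≤ n
height-≤ P? zero = z≤n
height-≤ P? (suc n) with P? 0
... | yes _ = s≤s (height-≤ (P? ∘ suc) n)
... | no _ = z≤n

<height⇒∈ : ∀ {P : Pred ℕ 0ℓ} (P? : Decidable P) n {j} → j < height P? n → P j
<height⇒∈ P? (suc n) j<h with P? 0
<height⇒∈ P? (suc n) {zero} j<h | yes P0 = P0
<height⇒∈ P? (suc n) {suc j} (s≤s j<h) | yes _ = <height⇒∈ (P? ∘ suc) n j<h

∈⇒<height : ∀ {P : Pred ℕ 0ℓ} (P? : Decidable P) n → (∀ {i j} → i ≤ j → P j → P i) →
  ∀ {j} → j < n → P j → j < height P? n
∈⇒<height P? (suc n) down j<n Pj with P? 0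
... | no ¬P0 = contradiction (down z≤n Pj) ¬P0
∈⇒<height P? (suc n) down {zero} j<n Pj | yes _ = z<s
∈⇒<height P? (suc n) down {suc j} (s≤s j<n) Pj | yes _ = s<s (∈⇒<height (P? ∘ suc) n (down ∘ s≤s) j<n Pj)

-- The search runs downwards from the bound; the given element `m` ensures that it does not reach
-- zero unsuccessfully.
greatest : ∀ {P : Pred ℕ 0ℓ} → Decidable P → ∀ n → (∀ {k} → P k → k < n) →
  ∀ {m} → P m → ∃[ i ] P i × (∀ {k} → P k → k ≤ i)
greatest P? zero bound Pm with () ← bound Pm
greatest P? (suc n) bound Pm with P? n
... | yes Pn = n , Pn , s≤s⁻¹ ∘ bound
... | no ¬Pn = greatest P? n (λ Pk → ≤∧≢⇒< (s≤s⁻¹ (bound Pk)) (λ { refl → ¬Pn Pk })) Pm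

-- Box partitions as decidable ideals of the grid.

record IsIdeal (p q : ℕ) (X : CellSet) : Set where
  field
    -- Decidability makes the row lengths computable, so that a vertex can be rebuilt from its
    -- cells.
    _∈? : Decidable X
    down-closed : DownClosed X
    bounded : ∀ {i j} → (i , j) ∈ X → i < q × j < p

open IsIdeal

cells : ∀ {p q} → BoxPartition p q → CellSet
cells x (i , j) = j < row (parts x) i

cells-isIdeal : ∀ {p q} (x : BoxPartition p q) → IsIdeal p q (cells x)
cells-isIdeal x = record
  { _∈? = λ (i , j) → j <? row (parts x) i
  ; down-closed = λ (i≤k , j≤l) l<r → ≤-<-trans j≤l (<-≤-trans l<r (row-antitone (chain x) i≤k))
  ; bounded = λ {i} j<r → row-nonzero⇒< (parts x) i j<r , <-≤-trans j<r (row-≤-bound (chain x) i)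
  }

cells-injective : ∀ {p q} {x y : BoxPartition p q} → cells x ≐ cells y → x ≡ y
cells-injective (x⊆y , y⊆x) = parts-injective (row-injective λ i →
  ≤-antisym (⊆⇒≤ (λ {j} → x⊆y {i , j})) (⊆⇒≤ (λ {j} → y⊆x {i , j})))

module _ {p q : ℕ} {X : CellSet} (I : IsIdeal p q X) where

  private
    rowHeight : ℕ → ℕ
    rowHeight i = height (λ j → (I ∈?) (i , j)) p

    <rowHeight⇒∈ : ∀ {i j} → j < rowHeight i → (i , j) ∈ X
    <rowHeight⇒∈ = <height⇒∈ _ p

    ∈⇒<rowHeight : ∀ {i j} → (i , j) ∈ X → j < rowHeight i
    ∈⇒<rowHeight ij∈X =
      ∈⇒<height _ p (λ j≤l → down-closed I (≤-refl , j≤l)) (proj₂ (bounded I ij∈X)) ij∈X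

    rowHeight-antitone : ∀ i → rowHeight (suc i) ≤ rowHeight i
    rowHeight-antitone i = ⊆⇒≤ λ j<h →
      ∈⇒<rowHeight (down-closed I (n≤1+n i , ≤-refl) (<rowHeight⇒∈ j<h))

  -- abstract, as unfolding fromIdeal makes conversion checking very slow
  abstract
    fromIdeal : BoxPartition p q
    fromIdeal = mkBoxPartition (tabulateRows q rowHeight)
      (tabulateRows-chain q (height-≤ _ p) rowHeight-antitone)

    cells-fromIdeal : cells fromIdeal ≐ X
    cells-fromIdeal = to , from
      where
      to : cells fromIdeal ⊆ X
      to {i , j} j<r = <rowHeight⇒∈
        (subst (j <_) (row-tabulateRows rowHeight (row-nonzero⇒< (parts fromIdeal) i j<r)) j<r)
      from : X ⊆ cells fromIdeal
      from {i , j} ij∈X =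
        subst (j <_) (sym (row-tabulateRows rowHeight (proj₁ (bounded I ij∈X)))) (∈⇒<rowHeight ij∈X)

-- Rank, and adjacency as covering.

rank : ∀ {p q} → BoxPartition p q → ℕ
rank x = sum (parts x)

addsOne⇒⋖ : ∀ {p q} {x y : BoxPartition p q} → AddsOne x y → cells x ⋖ cells y
addsOne⇒⋖ {x = mkBoxPartition v _} {mkBoxPartition _ _} (i , refl) =
  -- The new cell is the first one past the end of row `i`.
  (toℕ i , row v (toℕ i)) , <-irrefl refl , split , merge
  where
  c : Cell
  c = toℕ i , row v (toℕ i)
  split : ∀ {d} → proj₂ d < row (v [ i ]%= suc) (proj₁ d) → proj₂ d < row v (proj₁ d) ⊎ c ≡ d
  split {k , l} l<r with k ≟ toℕ i
  ... | no k≢i = inj₁ (subst (l <_) (row-updateAt-≢ v i suc k≢i) l<r)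
  ... | yes refl with m≤n⇒m<n∨m≡n (s≤s⁻¹ (subst (l <_) (row-updateAt v i suc) l<r))
  ...   | inj₁ l<r′ = inj₁ l<r′
  ...   | inj₂ refl = inj₂ refl
  merge : ∀ {d} → proj₂ d < row v (proj₁ d) ⊎ c ≡ d → proj₂ d < row (v [ i ]%= suc) (proj₁ d)
  merge (inj₂ refl) = subst (row v (toℕ i) <_) (sym (row-updateAt v i suc)) (n<1+n _)
  merge {k , l} (inj₁ l<r) with k ≟ toℕ i
  ... | no k≢i = subst (l <_) (sym (row-updateAt-≢ v i suc k≢i)) l<r
  ... | yes refl = subst (l <_) (sym (row-updateAt v i suc)) (≤-trans l<r (n≤1+n _))

⋖⇒addsOne : ∀ {p q} {x y : BoxPartition p q} → cells x ⋖ cells y → AddsOne x y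
⋖⇒addsOne {q = q} {x} {y} ((k , l) , c∉x , y⊆ , ⊆y) = i , row-injective rows
  where
  c∈y : (k , l) ∈ cells y
  c∈y = ⊆y (inj₂ refl)
  i : Fin q
  i = fromℕ< (row-nonzero⇒< (parts y) k c∈y)
  i≡k : toℕ i ≡ k
  i≡k = toℕ-fromℕ< _
  row-k : row (parts y) k ≡ suc (row (parts x) k)
  -- The new cell must sit exactly at the end of its row: otherwise the end cell of that row, lying
  -- to its left, would be a second cell of `y` outside `x`.
  row-k with m≤n⇒m<n∨m≡n (≮⇒≥ c∉x)
  ... | inj₁ r<l with y⊆ (down-closed (cells-isIdeal y) (≤-refl {k} , <⇒≤ r<l) c∈y)
  ...   | inj₁ r<r = contradiction r<r (<-irrefl refl)
  ...   | inj₂ refl = contradiction r<l (<-irrefl refl)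
  row-k | inj₂ refl = ≤-antisym (⊆⇒≤ λ j<r → [ m<n⇒m<1+n , (λ { refl → ≤-refl }) ]′ (y⊆ {k , _} j<r)) c∈y
  row-≢ : ∀ {m} → m ≢ k → row (parts y) m ≡ row (parts x) m
  row-≢ {m} m≢k = ≤-antisym
    (⊆⇒≤ λ j<r → [ id , (λ { refl → contradiction refl m≢k }) ]′ (y⊆ {m , _} j<r))
    (⊆⇒≤ λ j<r → ⊆y {m , _} (inj₁ j<r))
  rows : ∀ m → row (parts y) m ≡ row (parts x [ i ]%= suc) m
  rows m with m ≟ k
  ... | yes refl = trans row-k (sym (subst (λ n → row (parts x [ i ]%= suc) n ≡ suc (row (parts x) n)) i≡k
                                      (row-updateAt (parts x) i suc)))
  ... | no m≢k = trans (row-≢ m≢k) (sym (row-updateAt-≢ (parts x) i suc (λ m≡i → m≢k (trans m≡i i≡k))))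

sum-updateAt-suc : ∀ {n} (v : Vec ℕ n) i → sum (v [ i ]%= suc) ≡ suc (sum v)
sum-updateAt-suc (m ∷ v) zero = refl
sum-updateAt-suc (m ∷ v) (suc i) = trans (cong (m +_) (sum-updateAt-suc v i)) (+-suc m (sum v))

rank-⋖ : ∀ {p q} (x y : BoxPartition p q) → cells x ⋖ cells y → rank y ≡ suc (rank x)
rank-⋖ x y x⋖y with i , eq ← ⋖⇒addsOne {x = x} {y} x⋖y = trans (cong sum eq) (sum-updateAt-suc (parts x) i)

-- The empty vertex, corners and lower covers.

∅-isIdeal : ∀ {p q} → IsIdeal p q (λ _ → ⊥)
∅-isIdeal = record { _∈? = λ _ → no id ; down-closed = λ _ () ; bounded = λ () }

∅ : ∀ {p q} → BoxPartition p q
∅ = fromIdeal ∅-isIdeal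

cells-∅ : ∀ {p q c} → c ∉ cells (∅ {p} {q})
cells-∅ {p} {q} = proj₁ (cells-fromIdeal (∅-isIdeal {p} {q}))

∅-minimal : ∀ {p q} {x : BoxPartition p q} → ¬ (cells x ⋖ cells (∅ {p} {q}))
∅-minimal {p} {q} (_ , _ , _ , ⊆∅) = cells-∅ {p} {q} (⊆∅ (inj₂ refl))

≡∅ : ∀ {p q} {x : BoxPartition p q} → (0 , 0) ∉ cells x → x ≡ ∅
≡∅ {p} {q} {x} 0∉x = cells-injective
  ((λ d∈x → contradiction (down-closed (cells-isIdeal x) (z≤n , z≤n) d∈x) 0∉x) ,
   λ d∈∅ → contradiction d∈∅ (cells-∅ {p} {q}))

Maximal : CellSet → Cell → Set
Maximal X c = c ∈ X × (∀ {d} → c ≤ᶜ d → d ∈ X → d ≡ c)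

∖-isIdeal : ∀ {p q X c} → IsIdeal p q X → Maximal X c → IsIdeal p q (X ∖ c)
∖-isIdeal {c = c} I (_ , max) = record
  { _∈? = λ d → (I ∈?) d ×-dec ¬? (d ≟ᶜ c)
  ; down-closed = λ { d≤e (e∈X , e≢c) →
      down-closed I d≤e e∈X , (λ { refl → e≢c (max d≤e e∈X) }) }
  ; bounded = bounded I ∘ proj₁
  }

remove : ∀ {p q} (x : BoxPartition p q) {c} → Maximal (cells x) c →
  Σ (BoxPartition p q) λ u → cells u ≐ cells x ∖ c × cells u ⋖ cells x
remove x m = fromIdeal I , cells-fromIdeal I ,
  ⋖-resp-≐ (≐-sym (cells-fromIdeal I)) ≐-refl (∖-⋖ (proj₁ m))
  where I = ∖-isIdeal (cells-isIdeal x) m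

-- The corner is the last cell of the last nonempty row. Its row index bounds all others, which
-- together with the choice of column makes it maximal.
bottom-corner : ∀ {p q X} → IsIdeal p q X → (0 , 0) ∈ X →
  ∃[ c ] Maximal X c × (∀ {d} → d ∈ X → proj₁ d ≤ proj₁ c)
bottom-corner {p} {q} {X} I 0∈X
  with i , i0∈X , i-max ← greatest (λ i → (I ∈?) (i , 0)) q (proj₁ ∘ bounded I) 0∈X
  with j , ij∈X , j-max ← greatest (λ j → (I ∈?) (i , j)) p (proj₂ ∘ bounded I) i0∈X
  = (i , j) , (ij∈X , max) , below
  where
  below : ∀ {d} → d ∈ X → proj₁ d ≤ i
  below d∈X = i-max (down-closed I (≤-refl , z≤n) d∈X)
  max : ∀ {d} → (i , j) ≤ᶜ d → d ∈ X → d ≡ (i , j)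
  max (i≤k , j≤l) kl∈X =
    ≤ᶜ-antisym (below kl∈X , j-max (down-closed I (i≤k , ≤-refl) kl∈X)) (i≤k , j≤l)

transpose-isIdeal : ∀ {p q X} → IsIdeal p q X → IsIdeal q p (X ∘ swap)
transpose-isIdeal I = record
  { _∈? = (I ∈?) ∘ swap
  ; down-closed = λ c≤d → down-closed I (swap c≤d)
  ; bounded = swap ∘ bounded I
  }

-- This is the bottom corner of the transposed ideal.
right-corner : ∀ {p q X} → IsIdeal p q X → (0 , 0) ∈ X →
  ∃[ c ] Maximal X c × (∀ {d} → d ∈ X → proj₂ d ≤ proj₂ c)
right-corner I 0∈X with c , (c∈X , max) , right ← bottom-corner (transpose-isIdeal I) 0∈X
  = swap c , (c∈X , (λ c≤d d∈X → cong swap (max (swap c≤d) d∈X))) , right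

data Shape {p q} (x : BoxPartition p q) : Set where
  empty : x ≡ ∅ → Shape x
  rectangle : ∀ a → cells x ≐ ↓ a → Shape x
  two-lower-covers : ∀ (u v : BoxPartition p q) → u ≢ v → cells u ⋖ cells x → cells v ⋖ cells x → Shape x

-- If the bottom and right corners coincide, their bounds on rows and columns enclose a rectangle;
-- if they differ, removing either one gives a lower cover.
shape : ∀ {p q} (x : BoxPartition p q) → Shape x
shape x with (cells-isIdeal x ∈?) (0 , 0)
... | no 0∉x = empty (≡∅ 0∉x)
... | yes 0∈x
  with b , b-max , below ← bottom-corner (cells-isIdeal x) 0∈x
     | r , r-max , right ← right-corner (cells-isIdeal x) 0∈x
  with b ≟ᶜ r
... | yes refl = rectangle b
  ( (λ d∈x → below d∈x , right d∈x)
  , (λ d≤b → down-closed (cells-isIdeal x) d≤b (proj₁ b-max)))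
... | no b≢r
  with u , u≐ , u⋖x ← remove x b-max | v , v≐ , v⋖x ← remove x r-max
  = two-lower-covers u v u≢v u⋖x v⋖x
  where
  u≢v : u ≢ v
  -- The cell `b` survives the removal of `r` but not its own removal.
  u≢v refl = proj₂ (proj₁ u≐ (proj₂ v≐ (proj₁ b-max , b≢r))) refl

rectangle-lower-cover : ∀ {p q} {x : BoxPartition p q} {a} → cells x ≐ ↓ a →
  Σ (BoxPartition p q) λ u → cells u ≐ ↓ a ∖ a × cells u ⋖ cells x
rectangle-lower-cover {x = x} {a} (x⊆↓a , ↓a⊆x)
  with u , _ , u⋖x ← remove x {a} (↓a⊆x ≤ᶜ-refl , λ a≤d d∈x → ≤ᶜ-antisym (x⊆↓a d∈x) a≤d)
  = u , lower-cover-of-rectangle {X = cells x} (down-closed (cells-isIdeal u)) u⋖x (x⊆↓a , ↓a⊆x) , u⋖x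

lower-cover : ∀ {p q} (x : BoxPartition p q) → x ≡ ∅ ⊎ Σ (BoxPartition p q) λ u → cells u ⋖ cells x
lower-cover x with shape x
... | empty x≡∅ = inj₁ x≡∅
... | rectangle a x≐ with u , _ , u⋖x ← rectangle-lower-cover {x = x} x≐ = inj₂ (u , u⋖x)
lower-cover x | two-lower-covers u _ _ u⋖x _ = inj₂ (u , u⋖x)

sum≡0 : ∀ {n} (v : Vec ℕ n) → (∀ i → row v i ≡ 0) → sum v ≡ 0
sum≡0 [] _ = refl
sum≡0 (m ∷ v) eq rewrite eq 0 = sum≡0 v (eq ∘ suc)

rank-∅ : ∀ {p q} → rank (∅ {p} {q}) ≡ 0
rank-∅ {p} {q} = sum≡0 (parts (∅ {p} {q})) λ i → n≤0⇒n≡0 (≮⇒≥ (cells-∅ {p} {q} {i , 0}))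

rank≡0⇒∅ : ∀ {p q} (x : BoxPartition p q) → rank x ≡ 0 → x ≡ ∅
rank≡0⇒∅ x rk≡0 with lower-cover x
... | inj₁ x≡∅ = x≡∅
... | inj₂ (u , u⋖x) with () ← trans (sym rk≡0) (rank-⋖ u x u⋖x)

-- Complement and transposition

transpose : ∀ {p q} → BoxPartition p q → BoxPartition q p
transpose x = fromIdeal (transpose-isIdeal (cells-isIdeal x))

cells-transpose : ∀ {p q} (x : BoxPartition p q) → cells (transpose x) ≐ cells x ∘ swap
cells-transpose x = cells-fromIdeal (transpose-isIdeal (cells-isIdeal x))

transpose-involutive : ∀ {p q} (x : BoxPartition p q) → transpose (transpose x) ≡ x
transpose-involutive x = cells-injective
  ( (λ {d} d∈ → proj₁ (cells-transpose x) (proj₁ (cells-transpose (transpose x)) {d} d∈))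
  , (λ {d} d∈ → proj₂ (cells-transpose (transpose x)) {d} (proj₂ (cells-transpose x) d∈)))

transpose-∅ : ∀ {p q} → transpose (∅ {p} {q}) ≡ ∅
transpose-∅ {p} {q} = ≡∅ (cells-∅ {p} {q} ∘ proj₁ (cells-transpose (∅ {p} {q})) {0 , 0})

transpose-⋖ : ∀ {p q} {x y : BoxPartition p q} → cells x ⋖ cells y → cells (transpose x) ⋖ cells (transpose y)
transpose-⋖ {x = x} {y} (c , c∉x , y⊆ , ⊆y) =
  ⋖-resp-≐ (≐-sym (cells-transpose x)) (≐-sym (cells-transpose y))
    ( swap c , c∉x
    , (λ {d} d∈ → [ inj₁ , inj₂ ∘ cong swap ]′ (y⊆ {swap d} d∈))
    , (λ {d} d∈ → ⊆y {swap d} ([ inj₁ , inj₂ ∘ cong swap ]′ d∈)))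

opposite : ℕ → ℕ → ℕ
opposite n i = n ∸ suc i

opposite-< : ∀ {n i} → i < n → opposite n i < n
opposite-< {n} {i} i<n = ∸-monoʳ-< {n} {suc i} {0} z<s i<n

opposite-involutive : ∀ {n i} → i < n → opposite n (opposite n i) ≡ i
opposite-involutive {suc n} (s≤s i≤n) = m∸[m∸n]≡n i≤n

-- The set complement within the grid, turned by 180 degrees to make it down-closed again. On parts
-- it sends `(λ₁ , … , λ_q)` to `(p - λ_q , … , p - λ₁)`.
complementCells : ℕ → ℕ → CellSet → CellSet
complementCells p q X (i , j) = (i < q × j < p) × (opposite q i , opposite p j) ∉ X

complement-isIdeal : ∀ {p q X} → IsIdeal p q X → IsIdeal p q (complementCells p q X)
complement-isIdeal {p} {q} I = record
  { _∈? = λ (i , j) → ((i <? q) ×-dec (j <? p)) ×-dec ¬? ((I ∈?) (opposite q i , opposite p j))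
  ; down-closed = λ { (i≤k , j≤l) ((k<q , l<p) , ∉X) →
      (≤-<-trans i≤k k<q , ≤-<-trans j≤l l<p) ,
      (λ ∈X → ∉X (down-closed I (∸-monoʳ-≤ q (s≤s i≤k) , ∸-monoʳ-≤ p (s≤s j≤l)) ∈X)) }
  ; bounded = proj₁
  }

complement : ∀ {p q} → BoxPartition p q → BoxPartition p q
complement x = fromIdeal (complement-isIdeal (cells-isIdeal x))

cells-complement : ∀ {p q} (x : BoxPartition p q) → cells (complement x) ≐ complementCells p q (cells x)
cells-complement x = cells-fromIdeal (complement-isIdeal (cells-isIdeal x))

oppositeCell : ℕ → ℕ → Cell → Cell
oppositeCell p q (i , j) = opposite q i , opposite p j

oppositeCell-involutive : ∀ {p q} {x : BoxPartition p q} {c} → c ∈ cells x →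
  oppositeCell p q (oppositeCell p q c) ≡ c
oppositeCell-involutive {x = x} c∈x with i<q , j<p ← bounded (cells-isIdeal x) c∈x
  rewrite opposite-involutive i<q | opposite-involutive j<p = refl

complement-involutive : ∀ {p q} (x : BoxPartition p q) → complement (complement x) ≡ x
complement-involutive {p} {q} x = cells-injective (to , from)
  where
  to : cells (complement (complement x)) ⊆ cells x
  to {i , j} d∈ with (i<q , j<p) , ∉cx ← proj₁ (cells-complement (complement x)) d∈
    with (cells-isIdeal x ∈?) (i , j)
  ... | yes d∈x = d∈x
  ... | no d∉x = contradiction
    (proj₂ (cells-complement x) ((opposite-< i<q , opposite-< j<p) ,
      subst (_∉ cells x) (sym (cong₂ _,_ (opposite-involutive i<q) (opposite-involutive j<p))) d∉x)) ∉cx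
  from : cells x ⊆ cells (complement (complement x))
  from d∈x = proj₂ (cells-complement (complement x)) (bounded (cells-isIdeal x) d∈x , λ ∈cx →
    proj₂ (proj₁ (cells-complement x) ∈cx)
      (subst (_∈ cells x) (sym (oppositeCell-involutive {x = x} d∈x)) d∈x))

-- Complementation reverses inclusion; the cell by which the complements differ is the half-turn
-- image of `c`.
complement-⋖ : ∀ {p q} {x y : BoxPartition p q} → cells x ⋖ cells y → cells (complement y) ⋖ cells (complement x)
complement-⋖ {p} {q} {x} {y} (c , c∉x , y⊆ , ⊆y) =
  ⋖-resp-≐ (≐-sym (cells-complement y)) (≐-sym (cells-complement x))
    ( oppositeCell p q c
    , (λ (_ , c∉y) → c∉y (subst (_∈ cells y) (sym cc≡c) c∈y))
    , split
    , merge)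
  where
  c∈y : c ∈ cells y
  c∈y = ⊆y (inj₂ refl)
  cc≡c : oppositeCell p q (oppositeCell p q c) ≡ c
  cc≡c = oppositeCell-involutive {x = y} c∈y
  split : complementCells p q (cells x) ⊆ complementCells p q (cells y) ∪ ｛ oppositeCell p q c ｝
  split {i , j} (bd@(i<q , j<p) , ∉x) with (cells-isIdeal y ∈?) (opposite q i , opposite p j)
  ... | no ∉y = inj₁ (bd , ∉y)
  ... | yes ∈y with y⊆ ∈y
  ...   | inj₁ ∈x = contradiction ∈x ∉x
  ...   | inj₂ refl = inj₂ (cong₂ _,_ (opposite-involutive i<q) (opposite-involutive j<p))
  merge : complementCells p q (cells y) ∪ ｛ oppositeCell p q c ｝ ⊆ complementCells p q (cells x)
  merge (inj₁ (bd , ∉y)) = bd , ∉y ∘ ⊆y ∘ inj₁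
  merge (inj₂ refl) with i<q , j<p ← bounded (cells-isIdeal y) c∈y =
    (opposite-< i<q , opposite-< j<p) , subst (_∉ cells x) (sym cc≡c) c∉x

transpose-complement : ∀ {p q} (x : BoxPartition p q) → transpose (complement x) ≡ complement (transpose x)
transpose-complement x = cells-injective
  ( (λ {d} d∈ → let (bd , ∉x) = proj₁ (cells-complement x) (proj₁ (cells-transpose (complement x)) {d} d∈)
                in proj₂ (cells-complement (transpose x)) (swap bd , ∉x ∘ proj₁ (cells-transpose x)))
  , (λ {d} d∈ → let (bd , ∉tx) = proj₁ (cells-complement (transpose x)) {d} d∈
                in proj₂ (cells-transpose (complement x)) {d}
                     (proj₂ (cells-complement x) (swap bd , ∉tx ∘ proj₂ (cells-transpose x)))))

-- Isomorphisms between the graphs of two boxes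

infix 4 _≃_

-- Source and target may differ, so that transposition, which leads from one box to another, can be
-- composed with automorphisms of a non-square box.
record _≃_ (Γ Δ : SimpleGraph) : Set where
  open SimpleGraph Γ using () renaming (Vertex to V; _~_ to _~₁_)
  open SimpleGraph Δ using () renaming (Vertex to W; _~_ to _~₂_)
  field
    to : V → W
    from : W → V
    to-from : ∀ y → to (from y) ≡ y
    from-to : ∀ x → from (to x) ≡ x
    to-~ : ∀ {x y} → x ~₁ y → to x ~₂ to y
    from-~ : ∀ {x y} → x ~₂ y → from x ~₁ from y

open _≃_

≃-sym : ∀ {Γ Δ} → Γ ≃ Δ → Δ ≃ Γ
≃-sym g = record
  { to = from g ; from = to g ; to-from = from-to g ; from-to = to-from g
  ; to-~ = from-~ g ; from-~ = to-~ g
  }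

infixr 9 _≃-∘_

_≃-∘_ : ∀ {Γ Δ Θ} → Δ ≃ Θ → Γ ≃ Δ → Γ ≃ Θ
g ≃-∘ h = record
  { to = to g ∘ to h
  ; from = from h ∘ from g
  ; to-from = λ y → trans (cong (to g) (to-from h (from g y))) (to-from g y)
  ; from-to = λ x → trans (cong (from h) (from-to g (to h x))) (from-to h x)
  ; to-~ = to-~ g ∘ to-~ h
  ; from-~ = from-~ h ∘ from-~ g
  }

to-injective : ∀ {Γ Δ} (g : Γ ≃ Δ) {x y} → to g x ≡ to g y → x ≡ y
to-injective g {x} {y} eq = trans (sym (from-to g x)) (trans (cong (from g) eq) (from-to g y))

≃⇒Automorphism : ∀ {Γ} → Γ ≃ Γ → Automorphism Γ
≃⇒Automorphism {Γ} g = record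
  { bijection = mk↔ₛ′ (to g) (from g) (to-from g) (from-to g)
  ; adjacency = λ x y → mk⇔ (to-~ g)
      (subst₂ (SimpleGraph._~_ Γ) (from-to g x) (from-to g y) ∘ from-~ g)
  }

Automorphism⇒≃ : ∀ {Γ} → Automorphism Γ → Γ ≃ Γ
Automorphism⇒≃ {Γ} f = record
  { to = Inverse.to b
  ; from = Inverse.from b
  ; to-from = Inverse.strictlyInverseˡ b
  ; from-to = Inverse.strictlyInverseʳ b
  ; to-~ = λ {x} {y} → Equivalence.to (Automorphism.adjacency f x y)
  ; from-~ = λ {x} {y} x~y → Equivalence.from (Automorphism.adjacency f (Inverse.from b x) (Inverse.from b y))
      (subst₂ (SimpleGraph._~_ Γ) (sym (Inverse.strictlyInverseˡ b x)) (sym (Inverse.strictlyInverseˡ b y)) x~y)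
  }
  where b = Automorphism.bijection f

infix 4 _~Π_

_~Π_ : ∀ {p q} → BoxPartition p q → BoxPartition p q → Set
_~Π_ {p} {q} = SimpleGraph._~_ (Π p q)

⋖⇒~ : ∀ {p q} {x y : BoxPartition p q} → cells x ⋖ cells y → x ~Π y
⋖⇒~ {x = x} {y} x⋖y = inj₁ (⋖⇒addsOne {x = x} {y} x⋖y)

~⇒⋖ : ∀ {p q} {x y : BoxPartition p q} → x ~Π y → cells x ⋖ cells y ⊎ cells y ⋖ cells x
~⇒⋖ {x = x} {y} (inj₁ e) = inj₁ (addsOne⇒⋖ {x = x} {y} e)
~⇒⋖ {x = x} {y} (inj₂ e) = inj₂ (addsOne⇒⋖ {x = y} {x} e)

transpose-~ : ∀ {p q} {x y : BoxPartition p q} → x ~Π y → transpose x ~Π transpose y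
transpose-~ {x = x} {y} x~y with ~⇒⋖ {x = x} {y} x~y
... | inj₁ x⋖y = ⋖⇒~ {x = transpose x} {transpose y} (transpose-⋖ {x = x} {y} x⋖y)
... | inj₂ y⋖x = swap⊎ (⋖⇒~ {x = transpose y} {transpose x} (transpose-⋖ {x = y} {x} y⋖x))

complement-~ : ∀ {p q} {x y : BoxPartition p q} → x ~Π y → complement x ~Π complement y
complement-~ {x = x} {y} x~y with ~⇒⋖ {x = x} {y} x~y
... | inj₁ x⋖y = swap⊎ (⋖⇒~ {x = complement y} {complement x} (complement-⋖ {x = x} {y} x⋖y))
... | inj₂ y⋖x = ⋖⇒~ {x = complement x} {complement y} (complement-⋖ {x = y} {x} y⋖x)

transpose-≃ : ∀ p q → Π p q ≃ Π q p
transpose-≃ p q = record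
  { to = transpose ; from = transpose
  ; to-from = transpose-involutive ; from-to = transpose-involutive
  ; to-~ = λ {x} {y} → transpose-~ {x = x} {y} ; from-~ = λ {x} {y} → transpose-~ {x = x} {y}
  }

complement-≃ : ∀ p q → Π p q ≃ Π p q
complement-≃ p q = record
  { to = complement ; from = complement
  ; to-from = complement-involutive ; from-to = complement-involutive
  ; to-~ = λ {x} {y} → complement-~ {x = x} {y} ; from-~ = λ {x} {y} → complement-~ {x = x} {y}
  }

-- Rooted isomorphisms preserve rank and covers.

Rooted : ∀ {p q p′ q′} → Π p q ≃ Π p′ q′ → Set
Rooted g = to g ∅ ≡ ∅

≃-sym-rooted : ∀ {p q p′ q′} (g : Π p q ≃ Π p′ q′) → Rooted g → Rooted (≃-sym g)
≃-sym-rooted g root = trans (cong (from g) (sym root)) (from-to g ∅)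

-- A vertex of rank n + 1 has a neighbour of rank n, so its image has rank n + 1
-- or n - 1; the latter is excluded by applying the statement to the inverse.
rank-preserved : ∀ n {p q p′ q′} (g : Π p q ≃ Π p′ q′) → Rooted g →
  ∀ x → rank x ≡ n → rank (to g x) ≡ n
rank-preserved zero {p} {q} {p′} {q′} g root x rk
  rewrite rank≡0⇒∅ x rk | root = rank-∅ {p′} {q′}
rank-preserved (suc n) {p} {q} g root x rk with lower-cover x
... | inj₁ refl with () ← trans (sym rk) (rank-∅ {p} {q})
rank-preserved (suc n) g root x rk | inj₂ (u , u⋖x)
  with rank-u ← suc-injective (trans (sym (rank-⋖ u x u⋖x)) rk)
  with rank-gu ← rank-preserved n g root u rank-u
  with ~⇒⋖ {x = to g u} {to g x} (to-~ g (⋖⇒~ {x = u} {x} u⋖x))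
... | inj₁ gu⋖gx = trans (rank-⋖ (to g u) (to g x) gu⋖gx) (cong suc rank-gu)
... | inj₂ gx⋖gu with rank-⋖ (to g x) (to g u) gx⋖gu
rank-preserved (suc zero) g root x rk | inj₂ (u , u⋖x) | inj₂ gx⋖gu | eq
  with () ← trans (sym rank-gu) eq
rank-preserved (suc (suc n)) g root x rk | inj₂ (u , u⋖x) | inj₂ gx⋖gu | eq =
  contradiction (trans (sym rk) (subst (λ y → rank y ≡ n) (from-to g x)
      (rank-preserved n (≃-sym g) (≃-sym-rooted g root) (to g x)
        (suc-injective (trans (sym eq) rank-gu)))))
    (λ ())

-- Adjacency of the images gives a cover in one of the two directions, and preservation of rank
-- selects the direction.
to-⋖ : ∀ {p q p′ q′} (g : Π p q ≃ Π p′ q′) → Rooted g →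
  ∀ {x y} → cells x ⋖ cells y → cells (to g x) ⋖ cells (to g y)
to-⋖ g root {x} {y} x⋖y with ~⇒⋖ {x = to g x} {to g y} (to-~ g (⋖⇒~ {x = x} {y} x⋖y))
... | inj₁ gx⋖gy = gx⋖gy
... | inj₂ gy⋖gx = contradiction
  (trans (sym (rank-preserved _ g root x refl))
    (trans (rank-⋖ (to g y) (to g x) gy⋖gx)
      (cong suc (trans (rank-preserved _ g root y refl) (rank-⋖ x y x⋖y)))))
  (<⇒≢ (n≤1+n _))

-- Rigidity of rooted isomorphisms.

Swaps : ∀ {p q p′ q′} → Π p q ≃ Π p′ q′ → BoxPartition p q → Set
Swaps g x = cells x ≐ ↓ (0 , 1) × cells (to g x) ≐ ↓ (1 , 0)
          ⊎ cells (to g x) ≐ ↓ (0 , 1) × cells x ≐ ↓ (1 , 0)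

-- The inductive step on rank. If `x` or its image has two lower covers, both are the union of the
-- same pair; otherwise, apart from the empty case, both are rectangles over a common lower cover,
-- hence equal or the row domino `↓ (0 , 1)` and the column domino `↓ (1 , 0)`.
fixes-or-swaps : ∀ {p q p′ q′} (g : Π p q ≃ Π p′ q′) → Rooted g → ∀ x →
  (∀ u → cells u ⋖ cells x → cells (to g u) ≐ cells u) →
  cells (to g x) ≐ cells x ⊎ Swaps g x
fixes-or-swaps {p} {q} {p′} {q′} g root x fixes with shape x | shape (to g x)
... | empty refl | _ rewrite root =
  inj₁ ((λ d∈ → contradiction d∈ (cells-∅ {p′} {q′})) , (λ d∈ → contradiction d∈ (cells-∅ {p} {q})))
... | two-lower-covers u v u≢v u⋖x v⋖x | _ = inj₁ (≐-sym (two-lower-covers-unique u⋖x v⋖x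
  (to-⋖ g root {u} {x} u⋖x) (to-⋖ g root {v} {x} v⋖x)
  (≐-sym (fixes u u⋖x)) (≐-sym (fixes v v⋖x)) (u≢v ∘ cells-injective)))
... | rectangle _ _ | two-lower-covers u v u≢v u⋖gx v⋖gx = inj₁
  (two-lower-covers-unique u⋖gx v⋖gx (pull u u⋖gx) (pull v v⋖gx)
    (fixed u u⋖gx) (fixed v v⋖gx) (u≢v ∘ cells-injective))
  where
  -- The inverse is rooted as well, so lower covers of the image come from lower covers of `x`, to
  -- which `fixes` applies.
  pull : ∀ w → cells w ⋖ cells (to g x) → cells (from g w) ⋖ cells x
  pull w w⋖gx = subst (λ y → cells (from g w) ⋖ cells y) (from-to g x)
    (to-⋖ (≃-sym g) (≃-sym-rooted g root) {w} {to g x} w⋖gx)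
  fixed : ∀ w → cells w ⋖ cells (to g x) → cells w ≐ cells (from g w)
  fixed w w⋖gx = subst (λ z → cells z ≐ cells (from g w)) (to-from g w) (fixes (from g w) (pull w w⋖gx))
-- A rectangle has a lower cover, whose image would lie below the empty vertex.
... | rectangle a x≐ | empty gx≡∅ with u , _ , u⋖x ← rectangle-lower-cover {x = x} x≐ =
  contradiction (subst (λ y → cells (to g u) ⋖ cells y) gx≡∅ (to-⋖ g root {u} {x} u⋖x))
    (∅-minimal {x = to g u})
fixes-or-swaps g root x fixes | rectangle a x≐ | rectangle b gx≐
  with u , u≐ , u⋖x ← rectangle-lower-cover {x = x} x≐
  with gu≐ ← lower-cover-of-rectangle {X = cells (to g x)} (down-closed (cells-isIdeal (to g u)))
               (to-⋖ g root {u} {x} u⋖x) gx≐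
  with rectangles-over-common-lower-cover u≐ (≐-trans (≐-sym (fixes u u⋖x)) gu≐)
... | inj₁ refl = inj₁ (≐-trans gx≐ (≐-sym x≐))
... | inj₂ (inj₁ (refl , refl)) = inj₂ (inj₁ (x≐ , gx≐))
... | inj₂ (inj₂ (refl , refl)) = inj₂ (inj₂ (gx≐ , x≐))

-- Induction on the rank bound `n`, as lower covers have smaller rank. Bounding the hypothesis as
-- well allows a use at rank 1, where swaps can be excluded before anything is known about the
-- dominoes.
fixed-below : ∀ {p q p′ q′} (g : Π p q ≃ Π p′ q′) → Rooted g → ∀ n →
  (∀ y → rank y ≤ n → ¬ Swaps g y) → ∀ x → rank x ≤ n → cells (to g x) ≐ cells x
fixed-below g root n no-swaps x rk =
  [ id , (λ swaps → contradiction swaps (no-swaps x rk)) ]′ (fixes-or-swaps g root x (below n no-swaps rk))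
  where
  below : ∀ n → (∀ y → rank y ≤ n → ¬ Swaps g y) → rank x ≤ n →
    ∀ u → cells u ⋖ cells x → cells (to g u) ≐ cells u
  below zero _ rk u u⋖x with () ← subst (_≤ 0) (rank-⋖ u x u⋖x) rk
  below (suc n) no-swaps rk u u⋖x = fixed-below g root n (λ y rk → no-swaps y (≤-trans rk (n≤1+n n))) u
    (s≤s⁻¹ (subst (_≤ suc n) (rank-⋖ u x u⋖x) rk))

-- A lower cover of such a rectangle still contains the cell `(0 , 0)`, so one can descend a second
-- time.
rank-rectangle : ∀ {p q} (x : BoxPartition p q) {a} → a ≢ (0 , 0) → cells x ≐ ↓ a → 1 < rank x
rank-rectangle {p} {q} x a≢0 x≐ with u , u≐ , u⋖x ← rectangle-lower-cover {x = x} x≐ | lower-cover u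
... | inj₁ refl = contradiction (proj₂ u≐ ((z≤n , z≤n) , a≢0 ∘ sym)) (cells-∅ {p} {q})
... | inj₂ (w , w⋖u) rewrite rank-⋖ u x u⋖x | rank-⋖ w u w⋖u = s≤s (s≤s z≤n)

-- A lower cover of `x` misses the only cell available and is therefore empty.
rank-single-cell : ∀ {p q} (x : BoxPartition p q) → cells x ⊆ ｛ 0 , 0 ｝ → rank x ≤ 1
rank-single-cell {p} {q} x x⊆ with lower-cover x
... | inj₁ refl = ≤-trans (≤-reflexive (rank-∅ {p} {q})) z≤n
... | inj₂ (u , u⋖x@(c , c∉u , _ , ⊆x)) =
  ≤-reflexive (trans (rank-⋖ u x u⋖x) (cong suc (trans (cong rank u≡∅) (rank-∅ {p} {q}))))
  where
  u≡∅ : u ≡ ∅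
  u≡∅ = ≡∅ (subst (_∉ cells u) (sym (x⊆ (⊆x (inj₂ refl)))) c∉u)

01≉10 : ∀ {X : CellSet} → X ≐ ↓ (0 , 1) → ¬ (X ≐ ↓ (1 , 0))
01≉10 (⊆01 , _) (_ , ⊇10) with (() , _) ← ⊆01 (⊇10 {1 , 0} (s≤s z≤n , z≤n))

-- A fixed row domino cannot go to the column domino, and by injectivity the column domino cannot go
-- to the row domino. No swap remains, at any rank.
fixed-of-fixed-domino : ∀ {p q p′ q′} (g : Π p q ≃ Π p′ q′) → Rooted g →
  ∀ r → cells r ≐ ↓ (0 , 1) → cells (to g r) ≐ ↓ (0 , 1) → ∀ x → cells (to g x) ≐ cells x
fixed-of-fixed-domino g root r r≐ gr≐ x = fixed-below g root (rank x) (λ y _ → no-swaps y) x ≤-refl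
  where
  no-swaps : ∀ y → ¬ Swaps g y
  no-swaps y (inj₁ (y≐01 , gy≐10)) with refl ← cells-injective {x = y} {r} (≐-trans y≐01 (≐-sym r≐)) = 01≉10 gr≐ gy≐10
  no-swaps y (inj₂ (gy≐01 , y≐10))
    with refl ← to-injective g (cells-injective {x = to g y} {to g r} (≐-trans gy≐01 (≐-sym gr≐))) = 01≉10 r≐ y≐10

-- Swapped vertices have two cells, so everything of rank at most 1 is fixed. This covers the lower
-- covers of `r`, and the dichotomy then applies to `r` itself.
fixes-or-swaps-domino : ∀ {p q p′ q′} (g : Π p q ≃ Π p′ q′) → Rooted g →
  ∀ r → cells r ≐ ↓ (0 , 1) → cells (to g r) ≐ ↓ (0 , 1) ⊎ cells (to g r) ≐ ↓ (1 , 0)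
fixes-or-swaps-domino g root r r≐ =
  conclude (fixes-or-swaps g root r λ u u⋖r → fixed-below g root 1 no-swaps u (rank-single-cell u (single u u⋖r)))
  where
  no-swaps : ∀ y → rank y ≤ 1 → ¬ Swaps g y
  no-swaps y rk (inj₁ (y≐ , _)) = <⇒≱ (rank-rectangle y (λ ()) y≐) rk
  no-swaps y rk (inj₂ (_ , y≐)) = <⇒≱ (rank-rectangle y (λ ()) y≐) rk
  single : ∀ u → cells u ⋖ cells r → cells u ⊆ ｛ 0 , 0 ｝
  single u u⋖r d∈u
    with lower-cover-of-rectangle {X = cells r} (down-closed (cells-isIdeal u)) u⋖r r≐
  ... | u⊆ , _ with u⊆ d∈u
  ...   | (z≤n , z≤n) , _ = refl
  ...   | (z≤n , s≤s z≤n) , d≢ = contradiction refl d≢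
  conclude : cells (to g r) ≐ cells r ⊎ Swaps g r → cells (to g r) ≐ ↓ (0 , 1) ⊎ cells (to g r) ≐ ↓ (1 , 0)
  conclude (inj₁ fixed) = inj₁ (≐-trans fixed r≐)
  conclude (inj₂ (inj₁ (_ , gr≐))) = inj₂ gr≐
  conclude (inj₂ (inj₂ (_ , r≐10))) = contradiction r≐10 (01≉10 r≐)

-- The image of the empty vertex.

∅-unique-neighbour : ∀ {p q} {x y : BoxPartition p q} → x ~Π ∅ → y ~Π ∅ → x ≡ y
∅-unique-neighbour {p} {q} {x} {y} x~∅ y~∅ =
  cells-injective (≐-trans (single {x} x~∅) (≐-sym (single {y} y~∅)))
  where
  single : ∀ {z : BoxPartition p q} → z ~Π ∅ → cells z ≐ ｛ 0 , 0 ｝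
  single {z} z~∅ with ~⇒⋖ {x = z} {∅} z~∅
  ... | inj₁ z⋖∅ = contradiction z⋖∅ (∅-minimal {x = z})
  ... | inj₂ (c , _ , z⊆ , ⊆z) = subst (λ c → cells z ≐ ｛ c ｝) (sym 0≡c)
    ((λ d∈z → in-singleton (z⊆ d∈z)) , (λ { refl → ⊆z (inj₂ refl) }))
    where
    in-singleton : ∀ {d} → d ∈ cells (∅ {p} {q}) ⊎ c ≡ d → c ≡ d
    in-singleton = [ (λ d∈∅ → contradiction d∈∅ (cells-∅ {p} {q})) , id ]′
    -- A neighbour of `∅` has a single cell, and down-closure forces it to be the origin.
    0≡c : (0 , 0) ≡ c
    0≡c = sym (in-singleton (z⊆ (down-closed (cells-isIdeal z) (z≤n , z≤n) (⊆z (inj₂ refl)))))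

full : ∀ {p q} → BoxPartition p q
full = complement ∅

cells-full : ∀ {p q i j} → i < q → j < p → (i , j) ∈ cells (full {p} {q})
cells-full {p} {q} i<q j<p = proj₂ (cells-complement (∅ {p} {q})) ((i<q , j<p) , cells-∅ {p} {q})

-- Every vertex other than ∅ and full has both a lower and an upper cover,
-- whereas ∅ has only one neighbour.
image-of-∅ : ∀ {p q p′ q′} (g : Π p q ≃ Π p′ q′) → to g ∅ ≡ ∅ ⊎ to g ∅ ≡ full
image-of-∅ g with lower-cover (to g ∅) | lower-cover (complement (to g ∅))
... | inj₁ t≡∅ | _ = inj₁ t≡∅
... | inj₂ _ | inj₁ ct≡∅ = inj₂ (trans (sym (complement-involutive (to g ∅))) (cong complement ct≡∅))
... | inj₂ (u , u⋖t) | inj₂ (w , w⋖ct) =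
  contradiction (trans (rank-⋖ t (complement w) t⋖cw) (cong suc (trans (rank-⋖ u t u⋖t) (cong (suc ∘ rank) u≡cw))))
    (<⇒≢ (n≤1+n _))
  where
  t = to g ∅
  t⋖cw : cells t ⋖ cells (complement w)
  t⋖cw = subst (λ x → cells x ⋖ cells (complement w)) (complement-involutive t)
    (complement-⋖ {x = w} {complement t} w⋖ct)
  neighbour : ∀ {x} → x ~Π t → from g x ~Π ∅
  neighbour {x} x~t = subst (from g x ~Π_) (from-to g ∅) (from-~ g x~t)
  u≡cw : u ≡ complement w
  u≡cw = to-injective (≃-sym g) (∅-unique-neighbour {x = from g u} {from g (complement w)}
    (neighbour (⋖⇒~ {x = u} {t} u⋖t)) (neighbour (swap⊎ (⋖⇒~ {x = t} {complement w} t⋖cw))))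

-- Automorphisms of a box with both sides at least 2.

rectangle-isIdeal : ∀ {p q i j} → i < q → j < p → IsIdeal p q (↓ (i , j))
rectangle-isIdeal {i = i} {j} i<q j<p = record
  { _∈? = λ (k , l) → (k ≤? i) ×-dec (l ≤? j)
  ; down-closed = λ (k≤ , l≤) (≤i , ≤j) → ≤-trans k≤ ≤i , ≤-trans l≤ ≤j
  ; bounded = λ (k≤i , l≤j) → ≤-<-trans k≤i i<q , ≤-<-trans l≤j j<p
  }

module _ {p q : ℕ} (2≤p : 2 ≤ p) (2≤q : 2 ≤ q) where

  private
    0<q : 0 < q
    0<q = ≤-trans (s≤s z≤n) 2≤q

    0<p : 0 < p
    0<p = ≤-trans (s≤s z≤n) 2≤p

    domino-isIdeal : IsIdeal p q (↓ (0 , 1))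
    domino-isIdeal = rectangle-isIdeal 0<q 2≤p

  domino : BoxPartition p q
  domino = fromIdeal domino-isIdeal

  cells-domino : cells domino ≐ ↓ (0 , 1)
  cells-domino = cells-fromIdeal domino-isIdeal

  full≢∅ : full {p} {q} ≢ ∅
  full≢∅ full≡∅ = cells-∅ {p} {q} (subst (λ x → (0 , 0) ∈ cells x) full≡∅ (cells-full 0<q 0<p))

  -- If `g` moves the row domino to the column domino, following `g` by transposition gives a rooted
  -- isomorphism that fixes it. The second outcome compares cells because the two vertices lie in
  -- different boxes.
  identity-or-transpose : (g : Π p q ≃ Π p q) → Rooted g →
    (∀ x → to g x ≡ x) ⊎ (∀ x → cells (transpose (to g x)) ≐ cells x)
  identity-or-transpose g root with fixes-or-swaps-domino g root domino cells-domino
  ... | inj₁ fixed = inj₁ λ x →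
    cells-injective {x = to g x} {x} (fixed-of-fixed-domino g root domino cells-domino fixed x)
  ... | inj₂ swapped = inj₂ (fixed-of-fixed-domino (transpose-≃ p q ≃-∘ g) tg-root domino cells-domino
      (≐-trans (cells-transpose (to g domino)) (≐-trans (swap≐ swapped) swap-10)))
    where
    tg-root : Rooted (transpose-≃ p q ≃-∘ g)
    tg-root = trans (cong transpose root) transpose-∅
    swap≐ : ∀ {X Y : CellSet} → X ≐ Y → (X ∘ swap) ≐ (Y ∘ swap)
    swap≐ (X⊆Y , Y⊆X) = (λ {d} → X⊆Y {swap d}) , (λ {d} → Y⊆X {swap d})
    swap-10 : (↓ (1 , 0) ∘ swap) ≐ ↓ (0 , 1)
    swap-10 = swap , swap

  -- The cells of `full` occupy the whole grid and must also fit into the transposed box. Its first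
  -- row gives `p ≤ q`, its first column `q ≤ p`.
  transposing⇒square : (g : Π p q ≃ Π p q) → (∀ x → cells (transpose (to g x)) ≐ cells x) → p ≡ q
  transposing⇒square g tg≐ = ≤-antisym
    (⊆⇒≤ λ j<p → proj₁ (in-box (cells-full 0<q j<p)))
    (⊆⇒≤ λ i<q → proj₂ (in-box (cells-full i<q 0<p)))
    where
    in-box : ∀ {i j} → (i , j) ∈ cells (full {p} {q}) → j < q × i < p
    in-box ij∈ = swap (bounded (cells-isIdeal (transpose (to g full))) (proj₂ (tg≐ full) ij∈))

  rooted-or-corooted : (g : Π p q ≃ Π p q) → Rooted g ⊎ Rooted (complement-≃ p q ≃-∘ g)
  rooted-or-corooted g with image-of-∅ g
  ... | inj₁ root = inj₁ root
  ... | inj₂ g∅≡full = inj₂ (trans (cong complement g∅≡full) (complement-involutive ∅))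

-- Recognising ℤ₂ and ℤ₂ × ℤ₂

module _ {a ℓ} (G : Group a ℓ) where
  open Group G hiding (refl; sym; trans)
  private module ≈ = Group G using (refl; sym; trans)
  open import Algebra.Properties.Group G using (identityʳ-unique; inverseˡ-unique)
  open import Relation.Binary.Reasoning.Setoid setoid

  infixl 8 _^ᵖ_

  -- Powers with exponent modulo 2; the exponent law needs `g` to square to the identity.
  _^ᵖ_ : Carrier → Parity → Carrier
  g ^ᵖ 0ℙ = ε
  g ^ᵖ 1ℙ = g

  ^ᵖ-homo : ∀ {g} → g ∙ g ≈ ε → ∀ s t → g ^ᵖ (s +ᵖ t) ≈ g ^ᵖ s ∙ g ^ᵖ t
  ^ᵖ-homo g²≈ε 0ℙ t = ≈.sym (identityˡ _)
  ^ᵖ-homo g²≈ε 1ℙ 0ℙ = ≈.sym (identityʳ _)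
  ^ᵖ-homo g²≈ε 1ℙ 1ℙ = ≈.sym g²≈ε

  ^ᵖ-comm : ∀ {g h} → g ∙ h ≈ h ∙ g → ∀ s t → g ^ᵖ s ∙ h ^ᵖ t ≈ h ^ᵖ t ∙ g ^ᵖ s
  ^ᵖ-comm gh≈hg 0ℙ t = ≈.trans (identityˡ _) (≈.sym (identityʳ _))
  ^ᵖ-comm gh≈hg 1ℙ 0ℙ = ≈.trans (identityʳ _) (≈.sym (identityˡ _))
  ^ᵖ-comm gh≈hg 1ℙ 1ℙ = gh≈hg

  module _ {b ℓ′} (H : Group b ℓ′) where
    private module H = Group H
    open import Algebra.Properties.Group H using (x∙y⁻¹≈ε⇒x≈y)

    -- A map out of the concrete group `H` is easily defined by cases, whereas `≅` asks for a map
    -- into it. The chosen preimages `σ` provide this inverse, and injectivity of `h` transfers the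
    -- group laws to `σ`.
    ≅-of-bijective-hom : (h : H.Carrier → Carrier) →
      (∀ {x y} → x H.≈ y → h x ≈ h y) →
      (∀ x y → h (x H.∙ y) ≈ h x ∙ h y) →
      (∀ x → h x ≈ ε → x H.≈ H.ε) →
      (∀ g → ∃[ x ] g ≈ h x) →
      G ≅ H
    ≅-of-bijective-hom h h-cong homo kernel onto = σ , record
      { isGroupMonomorphism = record
        { isGroupHomomorphism = record
          { isMonoidHomomorphism = record
            { isMagmaHomomorphism = record
              { isRelHomomorphism = record { cong = σ-cong }
              ; homo = λ x y → injective (begin
                  h (σ (x ∙ y))     ≈⟨ hσ (x ∙ y) ⟨
                  x ∙ y             ≈⟨ ∙-cong (hσ x) (hσ y) ⟩
                  h (σ x) ∙ h (σ y) ≈⟨ homo (σ x) (σ y) ⟨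
                  h (σ x H.∙ σ y)   ∎)
              }
            ; ε-homo = kernel (σ ε) (≈.sym (hσ ε))
            }
          ; ⁻¹-homo = λ x → injective (begin
              h (σ (x ⁻¹))      ≈⟨ hσ (x ⁻¹) ⟨
              x ⁻¹              ≈⟨ ⁻¹-cong (hσ x) ⟩
              h (σ x) ⁻¹        ≈⟨ ⁻¹-homo (σ x) ⟨
              h (σ x H.⁻¹)      ∎)
          }
        ; injective = λ {x} {y} σx≈σy → begin
            x       ≈⟨ hσ x ⟩
            h (σ x) ≈⟨ h-cong σx≈σy ⟩
            h (σ y) ≈⟨ hσ y ⟨
            y       ∎
        }
      ; surjective = λ x → h x , λ {g} g≈hx → injective (begin
          h (σ g) ≈⟨ hσ g ⟨
          g       ≈⟨ g≈hx ⟩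
          h x     ∎)
      }
      where
      σ : Carrier → H.Carrier
      σ g = proj₁ (onto g)
      hσ : ∀ g → g ≈ h (σ g)
      hσ g = proj₂ (onto g)
      ε-homo : h H.ε ≈ ε
      ε-homo = identityʳ-unique (h H.ε) (h H.ε) (begin
        h H.ε ∙ h H.ε   ≈⟨ homo H.ε H.ε ⟨
        h (H.ε H.∙ H.ε) ≈⟨ h-cong (H.identityˡ H.ε) ⟩
        h H.ε           ∎)
      ⁻¹-homo : ∀ x → h (x H.⁻¹) ≈ h x ⁻¹
      ⁻¹-homo x = inverseˡ-unique (h (x H.⁻¹)) (h x) (begin
        h (x H.⁻¹) ∙ h x  ≈⟨ homo (x H.⁻¹) x ⟨
        h (x H.⁻¹ H.∙ x)  ≈⟨ h-cong (H.inverseˡ x) ⟩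
        h H.ε             ≈⟨ ε-homo ⟩
        ε                 ∎)
      injective : ∀ {x y} → h x ≈ h y → x H.≈ y
      injective {x} {y} hx≈hy = x∙y⁻¹≈ε⇒x≈y x y (kernel (x H.∙ y H.⁻¹) (begin
        h (x H.∙ y H.⁻¹)   ≈⟨ homo x (y H.⁻¹) ⟩
        h x ∙ h (y H.⁻¹)   ≈⟨ ∙-cong hx≈hy (⁻¹-homo y) ⟩
        h y ∙ h y ⁻¹       ≈⟨ inverseʳ (h y) ⟩
        ε                  ∎))
      σ-cong : ∀ {x y} → x ≈ y → σ x H.≈ σ y
      σ-cong {x} {y} x≈y = injective (begin
        h (σ x) ≈⟨ hσ x ⟨
        x       ≈⟨ x≈y ⟩
        y       ≈⟨ hσ y ⟩
        h (σ y) ∎)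

  ≅ℤ₂ : ∀ g → g ∙ g ≈ ε → ¬ (g ≈ ε) → (∀ x → x ≈ ε ⊎ x ≈ g) → G ≅ ℤ₂
  ≅ℤ₂ g g²≈ε g≉ε classify =
    ≅-of-bijective-hom ℤ₂ (g ^ᵖ_) (λ { refl → ≈.refl }) (^ᵖ-homo g²≈ε) kernel
      (λ x → [ (0ℙ ,_) , (1ℙ ,_) ]′ (classify x))
    where
    kernel : ∀ s → g ^ᵖ s ≈ ε → s ≡ 0ℙ
    kernel 0ℙ _ = refl
    kernel 1ℙ g≈ε = contradiction g≈ε g≉ε

  ≅ℤ₂×ℤ₂ : ∀ g h → g ∙ g ≈ ε → h ∙ h ≈ ε → g ∙ h ≈ h ∙ g →
    ¬ (g ≈ ε) → ¬ (h ≈ ε) → ¬ (g ∙ h ≈ ε) →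
    (∀ x → x ≈ ε ⊎ x ≈ h ⊎ x ≈ g ⊎ x ≈ g ∙ h) → G ≅ ℤ₂ ×ᴳ ℤ₂
  ≅ℤ₂×ℤ₂ g h g²≈ε h²≈ε gh≈hg g≉ε h≉ε gh≉ε classify =
    ≅-of-bijective-hom (ℤ₂ ×ᴳ ℤ₂) φ (λ { (refl , refl) → ≈.refl }) homo kernel onto
    where
    φ : Parity × Parity → Carrier
    φ (s , t) = g ^ᵖ s ∙ h ^ᵖ t
    homo : ∀ x y → φ (Group._∙_ (ℤ₂ ×ᴳ ℤ₂) x y) ≈ φ x ∙ φ y
    -- Reassociation brings the two middle factors together so that they can be exchanged.
    homo (s , t) (s′ , t′) = begin
      g ^ᵖ (s +ᵖ s′) ∙ h ^ᵖ (t +ᵖ t′)           ≈⟨ ∙-cong (^ᵖ-homo g²≈ε s s′) (^ᵖ-homo h²≈ε t t′) ⟩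
      (g ^ᵖ s ∙ g ^ᵖ s′) ∙ (h ^ᵖ t ∙ h ^ᵖ t′)   ≈⟨ assoc _ _ _ ⟩
      g ^ᵖ s ∙ (g ^ᵖ s′ ∙ (h ^ᵖ t ∙ h ^ᵖ t′))   ≈⟨ ∙-congˡ (assoc _ _ _) ⟨
      g ^ᵖ s ∙ ((g ^ᵖ s′ ∙ h ^ᵖ t) ∙ h ^ᵖ t′)   ≈⟨ ∙-congˡ (∙-congʳ (^ᵖ-comm gh≈hg s′ t)) ⟩
      g ^ᵖ s ∙ ((h ^ᵖ t ∙ g ^ᵖ s′) ∙ h ^ᵖ t′)   ≈⟨ ∙-congˡ (assoc _ _ _) ⟩
      g ^ᵖ s ∙ (h ^ᵖ t ∙ (g ^ᵖ s′ ∙ h ^ᵖ t′))   ≈⟨ assoc _ _ _ ⟨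
      (g ^ᵖ s ∙ h ^ᵖ t) ∙ (g ^ᵖ s′ ∙ h ^ᵖ t′)   ∎
    kernel : ∀ x → φ x ≈ ε → proj₁ x ≡ 0ℙ × proj₂ x ≡ 0ℙ
    kernel (0ℙ , 0ℙ) _ = refl , refl
    kernel (0ℙ , 1ℙ) εh≈ε = contradiction (≈.trans (≈.sym (identityˡ h)) εh≈ε) h≉ε
    kernel (1ℙ , 0ℙ) gε≈ε = contradiction (≈.trans (≈.sym (identityʳ g)) gε≈ε) g≉ε
    kernel (1ℙ , 1ℙ) gh≈ε = contradiction gh≈ε gh≉ε
    onto : ∀ x → ∃[ s ] x ≈ φ s
    onto x with classify x
    ... | inj₁ x≈ε = (0ℙ , 0ℙ) , ≈.trans x≈ε (≈.sym (identityˡ ε))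
    ... | inj₂ (inj₁ x≈h) = (0ℙ , 1ℙ) , ≈.trans x≈h (≈.sym (identityˡ h))
    ... | inj₂ (inj₂ (inj₁ x≈g)) = (1ℙ , 0ℙ) , ≈.trans x≈g (≈.sym (identityʳ g))
    ... | inj₂ (inj₂ (inj₂ x≈gh)) = (1ℙ , 1ℙ) , x≈gh

-- The automorphism groups of non-square and square boxes.

complementᴬ : ∀ p q → Automorphism (Π p q)
complementᴬ p q = ≃⇒Automorphism (complement-≃ p q)

transposeᴬ : ∀ p → Automorphism (Π p p)
transposeᴬ p = ≃⇒Automorphism (transpose-≃ p p)

-- A rooted automorphism is the identity, since a transposing one would force `p ≡ q`. Any other
-- automorphism becomes rooted after complementation, hence is the complement.
Aut-nonsquare : ∀ {p q} → 2 ≤ p → 2 ≤ q → p ≢ q → Aut (Π p q) ≅ ℤ₂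
Aut-nonsquare {p} {q} 2≤p 2≤q p≢q =
  ≅ℤ₂ (Aut (Π p q)) (complementᴬ p q) complement-involutive
    (λ c≈ε → full≢∅ 2≤p 2≤q (c≈ε ∅)) classify
  where
  fixes-all : (g : Π p q ≃ Π p q) → Rooted g → ∀ x → to g x ≡ x
  fixes-all g root with identity-or-transpose 2≤p 2≤q g root
  ... | inj₁ g≗id = g≗id
  ... | inj₂ tg≐ = contradiction (transposing⇒square 2≤p 2≤q g tg≐) p≢q
  classify : ∀ f → Group._≈_ (Aut (Π p q)) f (Group.ε (Aut (Π p q)))
                   ⊎ Group._≈_ (Aut (Π p q)) f (complementᴬ p q)
  classify f with rooted-or-corooted 2≤p 2≤q (Automorphism⇒≃ f)
  ... | inj₁ root = inj₁ (fixes-all (Automorphism⇒≃ f) root)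
  ... | inj₂ root = inj₂ λ x → trans (sym (complement-involutive (Automorphism.apply f x)))
    (cong complement (fixes-all (complement-≃ p q ≃-∘ Automorphism⇒≃ f) root x))

Aut-square : ∀ {p} → 2 ≤ p → Aut (Π p p) ≅ ℤ₂ ×ᴳ ℤ₂
Aut-square {p} 2≤p =
  ≅ℤ₂×ℤ₂ (Aut (Π p p)) (complementᴬ p p) (transposeᴬ p) complement-involutive transpose-involutive
    (λ x → sym (transpose-complement x)) (λ c≈ε → full≢∅ 2≤p 2≤p (c≈ε ∅)) t≉ε
    -- Transposition fixes `∅`, so the product sends it to `full`.
    (λ ct≈ε → full≢∅ 2≤p 2≤p (trans (cong complement (sym transpose-∅)) (ct≈ε ∅))) classify
  where
  open Group (Aut (Π p p)) using (_≈_; ε; _∙_)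
  d = domino 2≤p 2≤p
  t≉ε : ¬ (transposeᴬ p ≈ ε)
  -- The transposed row domino contains `(1 , 0)`, which the row domino does not.
  t≉ε t≈ε with (() , _) ← proj₁ (cells-domino 2≤p 2≤p)
    (subst (λ x → (1 , 0) ∈ cells x) (t≈ε d)
      (proj₂ (cells-transpose d) {1 , 0} (proj₂ (cells-domino 2≤p 2≤p) (≤-refl , ≤-refl))))
  id-or-transpose : (g : Π p p ≃ Π p p) → Rooted g → (∀ x → to g x ≡ x) ⊎ (∀ x → to g x ≡ transpose x)
  id-or-transpose g root with identity-or-transpose 2≤p 2≤p g root
  ... | inj₁ g≗id = inj₁ g≗id
  ... | inj₂ tg≐ = inj₂ λ x → trans (sym (transpose-involutive (to g x)))
    (cong transpose (cells-injective {x = transpose (to g x)} {x} (tg≐ x)))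
  classify : ∀ f → f ≈ ε ⊎ f ≈ transposeᴬ p ⊎ f ≈ complementᴬ p p ⊎ f ≈ complementᴬ p p ∙ transposeᴬ p
  classify f with rooted-or-corooted 2≤p 2≤p (Automorphism⇒≃ f)
  ... | inj₁ root with id-or-transpose (Automorphism⇒≃ f) root
  ...   | inj₁ f≈ε = inj₁ f≈ε
  ...   | inj₂ f≈t = inj₂ (inj₁ f≈t)
  classify f | inj₂ root with id-or-transpose (complement-≃ p p ≃-∘ Automorphism⇒≃ f) root
  ...   | inj₁ cf≈ε = inj₂ (inj₂ (inj₁ λ x → trans (sym (complement-involutive (Automorphism.apply f x))) (cong complement (cf≈ε x))))
  ...   | inj₂ cf≈t = inj₂ (inj₂ (inj₂ λ x → trans (sym (complement-involutive (Automorphism.apply f x))) (cong complement (cf≈t x))))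

theorem6p6 : (p q : ℕ) → p ⊓ q ≥ 2 →
    (p ≢ q → Aut (Π p q) ≅ ℤ₂) × (p ≡ q → Aut (Π p q) ≅ ℤ₂ ×ᴳ ℤ₂)
theorem6p6 p q p⊓q≥2 = Aut-nonsquare 2≤p 2≤q , λ { refl → Aut-square 2≤p }
  where
  2≤p : 2 ≤ p
  2≤p = ≤-trans p⊓q≥2 (m⊓n≤m p q)
  2≤q : 2 ≤ q
  2≤q = ≤-trans p⊓q≥2 (m⊓n≤n p q)
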